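{- For each of the following $38$ sets $P$ of generalized patterns, $|S_n(P)|=n$ for every $n\ge 1$: $\{1\text{ - }23,2\text{ - }13,3\text{ - }12,21\text{ - }3\}$, $\{1\text{ - }23,2\text{ - }13,31\text{ - }2,21\text{ - }3\}$, $\{1\text{ - }23,2\text{ - }13,31\text{ - }2,3\text{ - }12\}$, $\{1\text{ - }23,21\text{ - }3,31\text{ - }2,3\text{ - }12\}$, $\{12\text{ - }3,3\text{ - }12,2\text{ - }13,21\text{ - }3\}$, $\{12\text{ - }3,31\text{ - }2,2\text{ - }13,21\text{ - }3\}$, $\{12\text{ - }3,31\text{ - }2,2\text{ - }13,3\text{ - }12\}$, $\{12\text{ - }3,31\text{ - }2,21\text{ - }3,3\text{ - }12\}$, $\{1\text{ - }23,2\text{ - }13,2\text{ - }31,21\text{ - }3\}$, $\{1\text{ - }23,2\text{ - }13,2\text{ - }31,23\text{ - }1\}$, $\{1\text{ - }23,2\text{ - }13,23\text{ - }1,21\text{ - }3\}$, $\{1\text{ - }23,21\text{ - }3,2\text{ - }31,23\text{ - }1\}$, $\{2\text{ - }13,2\text{ - }31,1\text{ - }32,21\text{ - }3\}$, $\{2\text{ - }13,2\text{ - }31,1\text{ - }32,23\text{ - }1\}$, $\{2\text{ - }13,23\text{ - }1,1\text{ - }32,21\text{ - }3\}$, $\{2\text{ - }13,2\text{ - }31,13\text{ - }2,21\text{ - }3\}$, $\{2\text{ - }13,2\text{ - }31,13\text{ - }2,23\text{ - }1\}$, $\{2\text{ - }13,2\text{ - }31,13\text{ - }2,1\text{ - }32\}$,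 $\{2\text{ - }13,23\text{ - }1,13\text{ - }2,21\text{ - }3\}$, $\{2\text{ - }13,23\text{ - }1,13\text{ - }2,1\text{ - }32\}$, $\{2\text{ - }31,21\text{ - }3,13\text{ - }2,23\text{ - }1\}$, $\{2\text{ - }31,21\text{ - }3,13\text{ - }2,1\text{ - }32\}$, $\{2\text{ - }31,21\text{ - }3,1\text{ - }32,23\text{ - }1\}$, $\{13\text{ - }2,21\text{ - }3,23\text{ - }1,1\text{ - }32\}$, $\{1\text{ - }23,2\text{ - }31,31\text{ - }2,23\text{ - }1\}$, $\{1\text{ - }23,2\text{ - }31,31\text{ - }2,3\text{ - }12\}$, $\{1\text{ - }23,23\text{ - }1,31\text{ - }2,3\text{ - }12\}$, $\{1\text{ - }23,2\text{ - }31,3\text{ - }12,23\text{ - }1\}$, $\{1\text{ - }23,2\text{ - }13,31\text{ - }2,12\text{ - }3\}$, $\{1\text{ - }23,2\text{ - }13,3\text{ - }12,12\text{ - }3\}$, $\{1\text{ - }23,2\text{ - }13,2\text{ - }31,12\text{ - }3\}$, $\{1\text{ - }23,2\text{ - }13,23\text{ - }1,12\text{ - }3\}$, $\{1\text{ - }23,21\text{ - }3,2\text{ - }31,12\text{ - }3\}$, $\{1\text{ - }23,21\text{ - }3,23\text{ - }1,12\text{ - }3\}$, $\{1\text{ - }23,21\text{ - }3,31\text{ - }2,12\text{ - }3\}$, $\{1\text{ - }23,21\text{ - }3,3\text{ - }12,12\text{ - }3\}$, $\{1\text{ - }23,2\text{ - }31,3\text{ - }12,12\text{ - }3\}$, $\{1\text{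 - }23,2\text{ - }31,31\text{ - }2,12\text{ - }3\}$.
   Context: $S_n$ is the set of permutations $\pi=\pi_1\pi_2\cdots\pi_n$ of $\{1,\dots,n\}$. For $abc$ a permutation of $123$, the generalized pattern $a\text{ - }bc$ is contained in $\pi$ if there are indices $i<j$ with $j+1\le n$ such that $\pi_i\pi_j\pi_{j+1}$ is order-isomorphic to $abc$; the generalized pattern $ab\text{ - }c$ is contained in $\pi$ if there are indices $i,k$ with $i+1<k\le n$ such that $\pi_i\pi_{i+1}\pi_k$ is order-isomorphic to $abc$. (Letters not separated by a dash must occur in adjacent positions; letters separated by a dash need not be adjacent.) $\pi$ avoids a pattern if it does not contain it. For a set $P$ of generalized patterns, $S_n(P)$ is the set of $\pi\in S_n$ avoiding every pattern in $P$. -}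

module Defs where

open import Data.Fin.Base using (Fin; toℕ; _<_)
open import Data.Fin.Permutation using (Permutation′; _⟨$⟩ʳ_)
open import Data.List.Base using (List; []; _∷_)
open import Data.List.Relation.Unary.All using (All)
import Data.Nat.Base as ℕ
open ℕ using (ℕ; suc)
open import Data.Product.Base using (Σ-syntax; ∃-syntax; _×_; proj₁)
import Data.Vec.Base as Vec
open Vec using (Vec; []; _∷_; lookup)
open import Function.Base using (_∘_)
open import Function.Bundles using (_⇔_; Inverse)
open import Level using (0ℓ)
open import Relation.Binary.Bundles using (Setoid)
import Relation.Binary.Construct.On as On
open import Relation.Binary.PropositionalEquality using (_≡_; setoid; _→-setoid_)
open import Relation.Nullary using (¬_)

OrderIsomorphic : ∀ {k} → Vec ℕ k → Vec ℕ k → Set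
OrderIsomorphic u v =
  ∀ s t → (lookup u s ℕ.< lookup u t) ⇔ (lookup v s ℕ.< lookup v t)

-- The letters are only ever instantiated to a permutation of 1, 2, 3.
data GenPattern : Set where
  a-bc ab-c : (a b c : ℕ) → GenPattern

-- The one-line notation of π is π ⟨$⟩ʳ 0, π ⟨$⟩ʳ 1, …; letters and positions
-- of π count from 0, which does not affect order-isomorphism.
letters : ∀ {n k} → Permutation′ n → Vec (Fin n) k → Vec ℕ k
letters π = Vec.map (toℕ ∘ (π ⟨$⟩ʳ_))

Contains : ∀ {n} → Permutation′ n → GenPattern → Set
Contains π (a-bc a b c) =
  ∃[ i ] ∃[ j ] ∃[ j′ ]
    i < j × toℕ j′ ≡ suc (toℕ j) ×
    OrderIsomorphic (letters π (i ∷ j ∷ j′ ∷ [])) (a ∷ b ∷ c ∷ [])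
Contains π (ab-c a b c) =
  ∃[ i ] ∃[ i′ ] ∃[ k ]
    toℕ i′ ≡ suc (toℕ i) × i′ < k ×
    OrderIsomorphic (letters π (i ∷ i′ ∷ k ∷ [])) (a ∷ b ∷ c ∷ [])

AvoidsAll : ∀ {n} → List GenPattern → Permutation′ n → Set
AvoidsAll P π = All (λ p → ¬ Contains π p) P

-- The set Sₙ(P). Two elements are identified when the underlying permutations
-- agree letter by letter, whatever the proofs of avoidance.
S : ℕ → List GenPattern → Setoid 0ℓ 0ℓ
S n P = On.setoid {B = Σ[ π ∈ Permutation′ n ] AvoidsAll P π}
                  (Fin n →-setoid Fin n) (λ σ → proj₁ σ ⟨$⟩ʳ_)

HasCardinality : Setoid 0ℓ 0ℓ → ℕ → Set
HasCardinality A m = Inverse A (setoid (Fin m))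

1-23 1-32 2-13 2-31 3-12 3-21 : GenPattern
12-3 13-2 21-3 23-1 31-2 32-1 : GenPattern
1-23 = a-bc 1 2 3
1-32 = a-bc 1 3 2
2-13 = a-bc 2 1 3
2-31 = a-bc 2 3 1
3-12 = a-bc 3 1 2
3-21 = a-bc 3 2 1
12-3 = ab-c 1 2 3
13-2 = ab-c 1 3 2
21-3 = ab-c 2 1 3
23-1 = ab-c 2 3 1
31-2 = ab-c 3 1 2
32-1 = ab-c 3 2 1

patternSets : List (List GenPattern)
patternSets =
  (1-23 ∷ 2-13 ∷ 3-12 ∷ 21-3 ∷ []) ∷
  (1-23 ∷ 2-13 ∷ 31-2 ∷ 21-3 ∷ []) ∷
  (1-23 ∷ 2-13 ∷ 31-2 ∷ 3-12 ∷ []) ∷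
  (1-23 ∷ 21-3 ∷ 31-2 ∷ 3-12 ∷ []) ∷
  (12-3 ∷ 3-12 ∷ 2-13 ∷ 21-3 ∷ []) ∷
  (12-3 ∷ 31-2 ∷ 2-13 ∷ 21-3 ∷ []) ∷
  (12-3 ∷ 31-2 ∷ 2-13 ∷ 3-12 ∷ []) ∷
  (12-3 ∷ 31-2 ∷ 21-3 ∷ 3-12 ∷ []) ∷
  (1-23 ∷ 2-13 ∷ 2-31 ∷ 21-3 ∷ []) ∷
  (1-23 ∷ 2-13 ∷ 2-31 ∷ 23-1 ∷ []) ∷
  (1-23 ∷ 2-13 ∷ 23-1 ∷ 21-3 ∷ []) ∷
  (1-23 ∷ 21-3 ∷ 2-31 ∷ 23-1 ∷ []) ∷
  (2-13 ∷ 2-31 ∷ 1-32 ∷ 21-3 ∷ []) ∷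
  (2-13 ∷ 2-31 ∷ 1-32 ∷ 23-1 ∷ []) ∷
  (2-13 ∷ 23-1 ∷ 1-32 ∷ 21-3 ∷ []) ∷
  (2-13 ∷ 2-31 ∷ 13-2 ∷ 21-3 ∷ []) ∷
  (2-13 ∷ 2-31 ∷ 13-2 ∷ 23-1 ∷ []) ∷
  (2-13 ∷ 2-31 ∷ 13-2 ∷ 1-32 ∷ []) ∷
  (2-13 ∷ 23-1 ∷ 13-2 ∷ 21-3 ∷ []) ∷
  (2-13 ∷ 23-1 ∷ 13-2 ∷ 1-32 ∷ []) ∷
  (2-31 ∷ 21-3 ∷ 13-2 ∷ 23-1 ∷ []) ∷
  (2-31 ∷ 21-3 ∷ 13-2 ∷ 1-32 ∷ []) ∷
  (2-31 ∷ 21-3 ∷ 1-32 ∷ 23-1 ∷ []) ∷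
  (13-2 ∷ 21-3 ∷ 23-1 ∷ 1-32 ∷ []) ∷
  (1-23 ∷ 2-31 ∷ 31-2 ∷ 23-1 ∷ []) ∷
  (1-23 ∷ 2-31 ∷ 31-2 ∷ 3-12 ∷ []) ∷
  (1-23 ∷ 23-1 ∷ 31-2 ∷ 3-12 ∷ []) ∷
  (1-23 ∷ 2-31 ∷ 3-12 ∷ 23-1 ∷ []) ∷
  (1-23 ∷ 2-13 ∷ 31-2 ∷ 12-3 ∷ []) ∷
  (1-23 ∷ 2-13 ∷ 3-12 ∷ 12-3 ∷ []) ∷
  (1-23 ∷ 2-13 ∷ 2-31 ∷ 12-3 ∷ []) ∷
  (1-23 ∷ 2-13 ∷ 23-1 ∷ 12-3 ∷ []) ∷
  (1-23 ∷ 21-3 ∷ 2-31 ∷ 12-3 ∷ []) ∷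
  (1-23 ∷ 21-3 ∷ 23-1 ∷ 12-3 ∷ []) ∷
  (1-23 ∷ 21-3 ∷ 31-2 ∷ 12-3 ∷ []) ∷
  (1-23 ∷ 21-3 ∷ 3-12 ∷ 12-3 ∷ []) ∷
  (1-23 ∷ 2-31 ∷ 3-12 ∷ 12-3 ∷ []) ∷
  (1-23 ∷ 2-31 ∷ 31-2 ∷ 12-3 ∷ []) ∷
  []

{-# OPTIONS --safe #-}
module Submission where

-- Each of the 38 sets falls into one of four classes, and all sets in a class
-- are avoided by the same permutations:
--
--   A  a first letter k, then the other letters in decreasing order;
--   B  the least letter inserted at position z into a decreasing word;
--   C  the z greatest letters in decreasing order, then the rest increasing;
--   D  z … 1 0 followed by n-1 … z+1.
--
-- These avoid three classical patterns, hence both dashed forms of each.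
-- Conversely, for A an ascent not at the start and the letter just before it
-- form a consecutive 123, 213 or 312. For B, C and D, let z be the position of
-- the least letter: combining it with adjacent letters forces the monotonicity
-- of π before z, after z and across z, so that every comparison of two
-- letters, and thus π itself, is determined by z.

open import Defs
open import Data.Empty using (⊥)
open import Data.Fin.Base
  using (Fin; zero; suc; toℕ; fromℕ; inject₁; punchIn; opposite; _<_; _≤_)
open import Data.Fin.Induction using (<-weakInduction)
open import Data.Fin.Patterns using (0F; 1F; 2F)
open import Data.Fin.Permutation
  using (Permutation′; _⟨$⟩ʳ_; _⟨$⟩ˡ_; _≈_; id; inverseˡ; inverseʳ; reverse; insert; remove;
         insert-remove; punchIn-permute)
open import Data.Fin.Properties
  using (_≟_; _≤?_; _<?_; <-cmp; <⇒≢; ≤∧≢⇒<; ≤-antisym; toℕ-inject₁; toℕ-fromℕ;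
         toℕ<n; suc-injective; punchIn-mono-≤; punchIn-cancel-≤; opposite-prop)
open import Data.List.Base using (List; []; _∷_)
open import Data.List.Membership.Propositional using (_∈_)
open import Data.List.Relation.Unary.All as All using (All; []; _∷_)
open import Data.List.Relation.Unary.Any as Any using (Any; here; there)
open import Data.Nat.Base as ℕ using (ℕ; suc; _≥_; z≤n; s≤s)
import Data.Nat.Properties as ℕ
open import Data.Product.Base using (∃-syntax; ∃₂; _×_; _,_; proj₁; proj₂)
open import Data.Sum.Base as Sum using (_⊎_; inj₁; inj₂; [_,_]′)
open import Data.Vec.Base as Vec using (Vec; []; _∷_; lookup)
import Data.Vec.Properties as Vec
open import Function.Base using (_∘_)
open import Function.Bundles using (_⇔_; mk⇔; Equivalence; Injection)
open import Function.Properties.Equivalence renaming (sym to ⇔-sym; trans to ⇔-trans) using ()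
open import Function.Properties.Inverse using (↔⇒↣)
open import Level using (0ℓ)
open import Relation.Binary.Core using (Rel)
open import Relation.Binary.Definitions using (DecidableEquality; tri<; tri≈; tri>)
open import Relation.Binary.PropositionalEquality
  using (_≡_; _≢_; refl; sym; trans; cong; subst; subst₂; ≢-sym)
open import Relation.Nullary using (¬_; Dec; yes; no; contradiction)
open import Relation.Nullary.Decidable
  using (True; toWitness; map′; from-yes; _×-dec_; _⊎-dec_)
open import Relation.Unary using (Decidable)

private
  variable
    k l n : ℕ
    P : List GenPattern

-- Order-isomorphism of words

-- Lets one verification, for increasing words, serve the other shapes: each is a rearrangement of
-- 123 by some `ρ`.
reindex : (u v : Vec ℕ k) (ρ : Vec (Fin k) l) → OrderIsomorphic u v →
          OrderIsomorphic (Vec.map (lookup u) ρ) (Vec.map (lookup v) ρ)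
reindex u v ρ u≅v s t
  rewrite Vec.lookup-map s (lookup u) ρ | Vec.lookup-map t (lookup u) ρ
        | Vec.lookup-map s (lookup v) ρ | Vec.lookup-map t (lookup v) ρ
  = u≅v (lookup ρ s) (lookup ρ t)

increasing-word-⇔ : ∀ {x y z} → x ℕ.< y → y ℕ.< z → ∀ s t →
  (lookup (x ∷ y ∷ z ∷ []) s ℕ.< lookup (x ∷ y ∷ z ∷ []) t) ⇔ s < t
increasing-word-⇔ {x} {y} {z} x<y y<z s t = mk⇔ (reflects s t) (preserves s t)
  where
  u = x ∷ y ∷ z ∷ []

  preserves : ∀ s t → s < t → lookup u s ℕ.< lookup u t
  preserves 0F 1F _ = x<y
  preserves 0F 2F _ = ℕ.<-trans x<y y<z
  preserves 1F 2F _ = y<z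
  preserves 1F 1F (s≤s ())
  preserves 2F 1F (s≤s ())
  preserves 2F 2F (s≤s (s≤s ()))

  reflects : ∀ s t → lookup u s ℕ.< lookup u t → s < t
  reflects s t us<ut with <-cmp s t
  ... | tri< s<t _ _ = s<t
  ... | tri≈ _ refl _ = contradiction us<ut (ℕ.<-irrefl refl)
  ... | tri> _ _ t<s = contradiction us<ut (ℕ.<-asym (preserves t s t<s))

module _ {x y z : ℕ} (x<y : x ℕ.< y) (y<z : y ℕ.< z) where

  iso-123 : OrderIsomorphic (x ∷ y ∷ z ∷ []) (1 ∷ 2 ∷ 3 ∷ [])
  iso-123 s t = ⇔-trans (increasing-word-⇔ x<y y<z s t)
                        (⇔-sym (increasing-word-⇔ ℕ.≤-refl ℕ.≤-refl s t))

  iso-132 : OrderIsomorphic (x ∷ z ∷ y ∷ []) (1 ∷ 3 ∷ 2 ∷ [])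
  iso-132 = reindex (x ∷ y ∷ z ∷ []) (1 ∷ 2 ∷ 3 ∷ []) (0F ∷ 2F ∷ 1F ∷ []) iso-123

  iso-213 : OrderIsomorphic (y ∷ x ∷ z ∷ []) (2 ∷ 1 ∷ 3 ∷ [])
  iso-213 = reindex (x ∷ y ∷ z ∷ []) (1 ∷ 2 ∷ 3 ∷ []) (1F ∷ 0F ∷ 2F ∷ []) iso-123

  iso-231 : OrderIsomorphic (y ∷ z ∷ x ∷ []) (2 ∷ 3 ∷ 1 ∷ [])
  iso-231 = reindex (x ∷ y ∷ z ∷ []) (1 ∷ 2 ∷ 3 ∷ []) (1F ∷ 2F ∷ 0F ∷ []) iso-123

  iso-312 : OrderIsomorphic (z ∷ x ∷ y ∷ []) (3 ∷ 1 ∷ 2 ∷ [])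
  iso-312 = reindex (x ∷ y ∷ z ∷ []) (1 ∷ 2 ∷ 3 ∷ []) (2F ∷ 0F ∷ 1F ∷ []) iso-123

-- Reads a comparison of letters off an occurrence: on the pattern side both numbers are literals,
-- so the implicit argument is found by evaluation.
holds : ∀ {A : Set} → A ⇔ (k ℕ.< l) → {True (k ℕ.<? l)} → A
holds A⇔k<l {k<l} = Equivalence.from A⇔k<l (toWitness k<l)

-- Shapes of patterns

shape : GenPattern → Vec ℕ 3
shape (a-bc a b c) = a ∷ b ∷ c ∷ []
shape (ab-c a b c) = a ∷ b ∷ c ∷ []

ContainsClassical : Permutation′ n → Vec ℕ 3 → Set
ContainsClassical π v = ∃[ i ] ∃[ j ] ∃[ k ]
  i < j × j < k × OrderIsomorphic (letters π (i ∷ j ∷ k ∷ [])) v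

AvoidsClassical : List (Vec ℕ 3) → Permutation′ n → Set
AvoidsClassical vs π = All (λ v → ¬ ContainsClassical π v) vs

adjacent-< : {i j : Fin n} → toℕ j ≡ suc (toℕ i) → i < j
adjacent-< j≡1+i = ℕ.≤-reflexive (sym j≡1+i)

contains⇒classical : (π : Permutation′ n) (p : GenPattern) →
                     Contains π p → ContainsClassical π (shape p)
contains⇒classical π (a-bc a b c) (i , j , j′ , i<j , j′≡1+j , iso) =
  i , j , j′ , i<j , adjacent-< j′≡1+j , iso
contains⇒classical π (ab-c a b c) (i , i′ , k , i′≡1+i , i′<k , iso) =
  i , i′ , k , adjacent-< i′≡1+i , i′<k , iso

ShapesIn : List (Vec ℕ 3) → List GenPattern → Set
ShapesIn vs P = All (λ p → shape p ∈ vs) P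

HasShape : Vec ℕ 3 → List GenPattern → Set
HasShape v P = Any (λ p → shape p ≡ v) P

avoidsClassical⇒avoidsAll : ∀ {vs} {π : Permutation′ n} → ShapesIn vs P →
                            AvoidsClassical vs π → AvoidsAll P π
avoidsClassical⇒avoidsAll {π = π} P⊆vs avoids =
  All.map (λ p∈vs → All.lookup avoids p∈vs ∘ contains⇒classical π _) P⊆vs

-- A shape does not record where the dash stands, so all that follows is that one of the two dashed
-- forms is avoided.
avoids-shape : ∀ {a b c} {π : Permutation′ n} → HasShape (a ∷ b ∷ c ∷ []) P → AvoidsAll P π →
               ¬ Contains π (a-bc a b c) ⊎ ¬ Contains π (ab-c a b c)
avoids-shape (here {x = a-bc _ _ _} refl) (¬p ∷ _) = inj₁ ¬p
avoids-shape (here {x = ab-c _ _ _} refl) (¬p ∷ _) = inj₂ ¬p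
avoids-shape (there v∈P) (_ ∷ avoids) = avoids-shape v∈P avoids

-- Adjacent positions

-- A discrete intermediate value argument: going back from `k`, the first position that satisfies
-- `U` is followed by one that does not. It turns facts about distant positions into facts about
-- adjacent ones.
adjacent-step : {U : Fin n → Set} → Decidable U → ∀ {j k} → j < k → U j → ¬ U k →
  ∃₂ λ m m′ → j ≤ m × toℕ m′ ≡ suc (toℕ m) × m′ ≤ k × U m × ¬ U m′
adjacent-step {n = suc n} {U} U? {j} j<k Uj ¬Uk =
  <-weakInduction Step (λ ()) step _ j<k ¬Uk
  where
  Step : Fin (suc n) → Set
  Step k = j < k → ¬ U k →
    ∃₂ λ m m′ → j ≤ m × toℕ m′ ≡ suc (toℕ m) × m′ ≤ k × U m × ¬ U m′

  step : ∀ k → Step (inject₁ k) → Step (suc k)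
  step k rec j<1+k ¬U[1+k]
    with j≤k ← subst (toℕ j ℕ.≤_) (sym (toℕ-inject₁ k)) (ℕ.s≤s⁻¹ j<1+k)
    with U? (inject₁ k)
  ... | yes Uk = inject₁ k , suc k , j≤k , cong suc (sym (toℕ-inject₁ k)) , ℕ.≤-refl , Uk , ¬U[1+k]
  ... | no ¬Uk
    with m , m′ , j≤m , eq , m′≤k , Um , ¬Um′ ← rec (≤∧≢⇒< j≤k λ { refl → ¬Uk Uj }) ¬Uk
    = m , m′ , j≤m , eq ,
      ℕ.≤-trans m′≤k (ℕ.≤-trans (ℕ.≤-reflexive (toℕ-inject₁ k)) (ℕ.n≤1+n _)) , Um , ¬Um′

-- The property of being at most `j` can only be lost right after `j`.
successor : {j k : Fin n} → j < k → ∃[ j′ ] toℕ j′ ≡ suc (toℕ j) × j′ ≤ k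
successor {j = j} {k} j<k
  with m , m′ , j≤m , eq , m′≤k , m≤j , _ ← adjacent-step (_≤? j) j<k ℕ.≤-refl (ℕ.<⇒≱ j<k)
  = m′ , trans eq (cong (suc ∘ toℕ) (≤-antisym m≤j j≤m)) , m′≤k

predecessor : {j k : Fin n} → j < k → ∃[ k′ ] toℕ k ≡ suc (toℕ k′) × j ≤ k′
predecessor {j = j} {k} j<k
  with m , m′ , j≤m , eq , m′≤k , _ , m′≮k ← adjacent-step (_<? k) j<k j<k (ℕ.<-irrefl refl)
  = m , subst (λ i → toℕ i ≡ _) (≤-antisym m′≤k (ℕ.≮⇒≥ m′≮k)) eq , j≤m

-- Dashed patterns equivalent to classical ones

module _ (π : Permutation′ n) where

  private
    πʳ : Fin n → Fin n
    πʳ = π ⟨$⟩ʳ_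

  ⟨$⟩ʳ-injective : ∀ {i j} → πʳ i ≡ πʳ j → i ≡ j
  ⟨$⟩ʳ-injective = Injection.injective (↔⇒↣ π)

  ≮⇒> : ∀ {i j} → i ≢ j → ¬ πʳ i < πʳ j → πʳ j < πʳ i
  ≮⇒> i≢j i≮j = ≤∧≢⇒< (ℕ.≮⇒≥ i≮j) (i≢j ∘ sym ∘ ⟨$⟩ʳ-injective)

  -- When the dash is next to the letter 2, adjacency of the other two letters
  -- is no restriction: on the way from one to the other, π crosses the level of
  -- the letter playing 2 in a single step.

  213⇒2-13 : ContainsClassical π (2 ∷ 1 ∷ 3 ∷ []) → Contains π 2-13
  213⇒2-13 (i , j , k , i<j , j<k , iso)
    with m , m′ , j≤m , eq , _ , πm<πi , πm′≮πi ←
      adjacent-step (λ m → πʳ m <? πʳ i) j<k (holds (iso 1F 0F)) (ℕ.<-asym (holds (iso 0F 2F)))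
    = let i<m = ℕ.<-≤-trans i<j j≤m
      in i , m , m′ , i<m , eq ,
         iso-213 πm<πi (≮⇒> (≢-sym (<⇒≢ (ℕ.<-trans i<m (adjacent-< eq)))) πm′≮πi)

  231⇒2-31 : ContainsClassical π (2 ∷ 3 ∷ 1 ∷ []) → Contains π 2-31
  231⇒2-31 (i , j , k , i<j , j<k , iso)
    with m , m′ , j≤m , eq , _ , πi<πm , πi≮πm′ ←
      adjacent-step (λ m → πʳ i <? πʳ m) j<k (holds (iso 0F 1F)) (ℕ.<-asym (holds (iso 2F 0F)))
    = let i<m = ℕ.<-≤-trans i<j j≤m
      in i , m , m′ , i<m , eq ,
         iso-231 (≮⇒> (<⇒≢ (ℕ.<-trans i<m (adjacent-< eq))) πi≮πm′) πi<πm

  132⇒13-2 : ContainsClassical π (1 ∷ 3 ∷ 2 ∷ []) → Contains π 13-2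
  132⇒13-2 (i , j , k , i<j , j<k , iso)
    with m , m′ , _ , eq , m′≤j , πm<πk , πm′≮πk ←
      adjacent-step (λ m → πʳ m <? πʳ k) i<j (holds (iso 0F 2F)) (ℕ.<-asym (holds (iso 2F 1F)))
    = let m′<k = ℕ.≤-<-trans m′≤j j<k
      in m , m′ , k , eq , m′<k , iso-132 πm<πk (≮⇒> (<⇒≢ m′<k) πm′≮πk)

  312⇒31-2 : ContainsClassical π (3 ∷ 1 ∷ 2 ∷ []) → Contains π 31-2
  312⇒31-2 (i , j , k , i<j , j<k , iso)
    with m , m′ , _ , eq , m′≤j , πk<πm , πk≮πm′ ←
      adjacent-step (λ m → πʳ k <? πʳ m) i<j (holds (iso 2F 0F)) (ℕ.<-asym (holds (iso 1F 2F)))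
    = let m′<k = ℕ.≤-<-trans m′≤j j<k
      in m , m′ , k , eq , m′<k , iso-312 (≮⇒> (≢-sym (<⇒≢ m′<k)) πk≮πm′) πk<πm

-- If `P` offers `2-13` rather than `21-3`, an occurrence of `21-3` is a classical 213 and so yields
-- a `2-13`. The next three lemmas make the same transfer for their shapes.
avoids-21-3 : {π : Permutation′ n} → HasShape (2 ∷ 1 ∷ 3 ∷ []) P → AvoidsAll P π → ¬ Contains π 21-3
avoids-21-3 {π = π} v∈P avoids =
  [ _∘ 213⇒2-13 π ∘ contains⇒classical π 21-3 , (λ ¬p → ¬p) ]′ (avoids-shape v∈P avoids)

avoids-23-1 : {π : Permutation′ n} → HasShape (2 ∷ 3 ∷ 1 ∷ []) P → AvoidsAll P π → ¬ Contains π 23-1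
avoids-23-1 {π = π} v∈P avoids =
  [ _∘ 231⇒2-31 π ∘ contains⇒classical π 23-1 , (λ ¬p → ¬p) ]′ (avoids-shape v∈P avoids)

avoids-1-32 : {π : Permutation′ n} → HasShape (1 ∷ 3 ∷ 2 ∷ []) P → AvoidsAll P π → ¬ Contains π 1-32
avoids-1-32 {π = π} v∈P avoids =
  [ (λ ¬p → ¬p) , _∘ 132⇒13-2 π ∘ contains⇒classical π 1-32 ]′ (avoids-shape v∈P avoids)

avoids-3-12 : {π : Permutation′ n} → HasShape (3 ∷ 1 ∷ 2 ∷ []) P → AvoidsAll P π → ¬ Contains π 3-12
avoids-3-12 {π = π} v∈P avoids =
  [ (λ ¬p → ¬p) , _∘ 312⇒31-2 π ∘ contains⇒classical π 3-12 ]′ (avoids-shape v∈P avoids)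

-- Permutations with the same relative order

preserves-<⇒expanding : (f : Fin n → Fin n) → (∀ {i j} → i < j → f i < f j) → ∀ i → i ≤ f i
preserves-<⇒expanding {n = suc n} f mono = <-weakInduction (λ i → i ≤ f i) z≤n λ i i≤fi →
  ℕ.≤-<-trans (subst (ℕ._≤ toℕ (f (inject₁ i))) (toℕ-inject₁ i) i≤fi)
              (mono (s≤s (ℕ.≤-reflexive (toℕ-inject₁ i))))

-- The map sending each letter of `π` to the letter of `σ` at the same position is strictly
-- increasing, hence expanding.
order-preserving⇒≤ : (π σ : Permutation′ n) →
  (∀ {i j} → π ⟨$⟩ʳ i < π ⟨$⟩ʳ j → σ ⟨$⟩ʳ i < σ ⟨$⟩ʳ j) → ∀ i → π ⟨$⟩ʳ i ≤ σ ⟨$⟩ʳ i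
order-preserving⇒≤ π σ mono i =
  subst (λ k → π ⟨$⟩ʳ i ≤ σ ⟨$⟩ʳ k) (inverseˡ π)
    (preserves-<⇒expanding (λ v → σ ⟨$⟩ʳ (π ⟨$⟩ˡ v))
      (λ u<v → mono (subst₂ _<_ (sym (inverseʳ π)) (sym (inverseʳ π)) u<v)) (π ⟨$⟩ʳ i))

-- `Asc` prescribes which pairs of positions `i < j` carry an ascent; all other pairs carry a
-- descent. This fixes the relative order of all letters.
record Profile (Asc : Rel (Fin n) 0ℓ) (π : Permutation′ n) : Set where
  field
    compare : ∀ {i j} → i < j →
      (Asc i j × π ⟨$⟩ʳ i < π ⟨$⟩ʳ j) ⊎ (¬ Asc i j × π ⟨$⟩ʳ j < π ⟨$⟩ʳ i)

open Profile

module _ {Asc : Rel (Fin n) 0ℓ} where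

  profile-asc : {π : Permutation′ n} → Profile Asc π →
                ∀ {i j} → i < j → π ⟨$⟩ʳ i < π ⟨$⟩ʳ j → Asc i j
  profile-asc prof i<j πi<πj with compare prof i<j
  ... | inj₁ (asc , _) = asc
  ... | inj₂ (_ , πj<πi) = contradiction πj<πi (ℕ.<-asym πi<πj)

  profile-¬asc : {π : Permutation′ n} → Profile Asc π →
                 ∀ {i j} → i < j → π ⟨$⟩ʳ j < π ⟨$⟩ʳ i → ¬ Asc i j
  profile-¬asc prof i<j πj<πi with compare prof i<j
  ... | inj₁ (_ , πi<πj) = contradiction πj<πi (ℕ.<-asym πi<πj)
  ... | inj₂ (¬asc , _) = ¬asc

  profile-order : {π σ : Permutation′ n} → Profile Asc π → Profile Asc σ →
                  ∀ {i j} → π ⟨$⟩ʳ i < π ⟨$⟩ʳ j → σ ⟨$⟩ʳ i < σ ⟨$⟩ʳ j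
  profile-order {π} {σ} profπ profσ {i} {j} πi<πj with <-cmp i j
  ... | tri≈ _ refl _ = contradiction πi<πj (ℕ.<-irrefl refl)
  ... | tri< i<j _ _ =
    [ proj₂ , (λ (¬asc , _) → contradiction (profile-asc profπ i<j πi<πj) ¬asc) ]′ (compare profσ i<j)
  ... | tri> _ _ j<i =
    [ (λ (asc , _) → contradiction asc (profile-¬asc profπ j<i πi<πj)) , proj₂ ]′ (compare profσ j<i)

  -- Equal profiles give the same relative order, so each permutation is pointwise at most the
  -- other.
  profile-unique : {π σ : Permutation′ n} → Profile Asc π → Profile Asc σ → π ≈ σ
  profile-unique {π} {σ} profπ profσ i = ≤-antisym
    (order-preserving⇒≤ π σ (profile-order profπ profσ) i)
    (order-preserving⇒≤ σ π (profile-order profσ profπ) i)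

-- Prepending a letter

prepend : Fin (suc n) → Permutation′ n → Permutation′ (suc n)
prepend = insert zero

punchIn-mono-< : ∀ (v : Fin (suc n)) {i j} → i < j → punchIn v i < punchIn v j
punchIn-mono-< v i<j = ℕ.≰⇒> (ℕ.<⇒≱ i<j ∘ punchIn-cancel-≤ v _ _)

punchIn-cancel-< : ∀ (v : Fin (suc n)) {i j} → punchIn v i < punchIn v j → i < j
punchIn-cancel-< v vi<vj = ℕ.≰⇒> (ℕ.<⇒≱ vi<vj ∘ punchIn-mono-≤ v _ _)

punchIn-below : ∀ (v : Fin (suc n)) i → toℕ i ℕ.< toℕ v → punchIn v i < v
punchIn-below (suc v) zero    _         = s≤s z≤n
punchIn-below (suc v) (suc i) (s≤s i<v) = s≤s (punchIn-below v i i<v)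

punchIn-above : ∀ (v : Fin (suc n)) i → toℕ v ℕ.≤ toℕ i → v < punchIn v i
punchIn-above zero    i       _         = s≤s z≤n
punchIn-above (suc v) (suc i) (s≤s v≤i) = s≤s (punchIn-above v i v≤i)

-- Inserting `v` raises the letters from `v` on by one, so the new letter lies below exactly the old
-- letters that are at least `v`, while the order among the old letters is kept.
prepend-profile : ∀ {Asc : Rel (Fin n) 0ℓ} {Asc′ : Rel (Fin (suc n)) 0ℓ} {π v} →
  (∀ {i j} → Asc i j ⇔ Asc′ (suc i) (suc j)) →
  (∀ j → (Asc′ zero (suc j) × toℕ v ℕ.≤ toℕ (π ⟨$⟩ʳ j)) ⊎
         (¬ Asc′ zero (suc j) × toℕ (π ⟨$⟩ʳ j) ℕ.< toℕ v)) →
  Profile Asc π → Profile Asc′ (prepend v π)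
compare (prepend-profile {v = v} _ first _) {zero} {suc j} _ with first j
... | inj₁ (asc , v≤πj) = inj₁ (asc , punchIn-above v _ v≤πj)
... | inj₂ (¬asc , πj<v) = inj₂ (¬asc , punchIn-below v _ πj<v)
compare (prepend-profile {v = v} Asc⇔ _ prof) {suc i} {suc j} (s≤s i<j) with compare prof i<j
... | inj₁ (asc , πi<πj) = inj₁ (Equivalence.to Asc⇔ asc , punchIn-mono-< v πi<πj)
... | inj₂ (¬asc , πj<πi) = inj₂ (¬asc ∘ Equivalence.from Asc⇔ , punchIn-mono-< v πj<πi)

opposite-anti-< : {i j : Fin n} → i < j → opposite j < opposite i
opposite-anti-< {i = i} {j} i<j rewrite opposite-prop i | opposite-prop j =
  ℕ.∸-monoʳ-< (s≤s i<j) (toℕ<n j)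

reverse-profile : Profile {n} (λ _ _ → ⊥) reverse
compare reverse-profile i<j = inj₂ ((λ ()) , opposite-anti-< i<j)

-- The count comes from a statistic that determines the avoider. `index` is defined on bare
-- permutations, so it cannot depend on the proofs of avoidance.
cardinality : (index : Permutation′ n → Fin n) → (∀ {π σ} → π ≈ σ → index π ≡ index σ) →
  (word : Fin n → Permutation′ n) → (∀ z → AvoidsAll P (word z)) →
  (∀ z → index (word z) ≡ z) → (∀ π → AvoidsAll P π → word (index π) ≈ π) →
  HasCardinality (S n P) n
cardinality index index-cong word avoids index-word word-index = record
  { to        = index ∘ proj₁
  ; from      = λ z → word z , avoids z
  ; to-cong   = index-cong
  ; from-cong = λ { refl _ → refl }
  ; inverse   = (λ {z} eq → trans (index-cong eq) (index-word z))
              , (λ { {π , π-avoids} refl → word-index π π-avoids })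
  }

-- Class A

TailDecreasing : Permutation′ (suc n) → Set
TailDecreasing π = ∀ {i j} → i < j → π ⟨$⟩ʳ suc j < π ⟨$⟩ʳ suc i

-- Removing the first letter leaves a permutation with no ascents, and `reverse` is the only one.
tailDecreasing⇒prepend-reverse : (π : Permutation′ (suc n)) → TailDecreasing π →
                                 prepend (π ⟨$⟩ʳ zero) reverse ≈ π
tailDecreasing⇒prepend-reverse π dec zero = refl
tailDecreasing⇒prepend-reverse π dec (suc i) = trans
  (cong (punchIn (π ⟨$⟩ʳ zero)) (profile-unique reverse-profile remove-profile i))
  (insert-remove zero π (suc i))
  where
  remove-profile : Profile (λ _ _ → ⊥) (remove zero π)
  compare remove-profile i<j = inj₂ ((λ ()) , punchIn-cancel-< (π ⟨$⟩ʳ zero)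
    (subst₂ _<_ (punchIn-permute π zero _) (punchIn-permute π zero _) (dec i<j)))

A-shapes : List (Vec ℕ 3)
A-shapes = (1 ∷ 2 ∷ 3 ∷ []) ∷ (2 ∷ 1 ∷ 3 ∷ []) ∷ (3 ∷ 1 ∷ 2 ∷ []) ∷ []

-- All three shapes end in an ascent, whose two positions lie past the first position.
tailDecreasing-avoids : (π : Permutation′ (suc n)) → TailDecreasing π → AvoidsClassical A-shapes π
tailDecreasing-avoids π dec =
  (λ (_ , _ , _ , i<j , j<k , iso) → no-ascent i<j j<k (holds (iso 1F 2F))) ∷
  (λ (_ , _ , _ , i<j , j<k , iso) → no-ascent i<j j<k (holds (iso 1F 2F))) ∷
  (λ (_ , _ , _ , i<j , j<k , iso) → no-ascent i<j j<k (holds (iso 1F 2F))) ∷ []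
  where
  no-ascent : ∀ {i j k} → i < j → j < k → ¬ π ⟨$⟩ʳ j < π ⟨$⟩ʳ k
  no-ascent {j = suc j} {suc k} _ (s≤s j<k) = ℕ.<-asym (dec j<k)

A-sufficient : List GenPattern → Set
A-sufficient P = ShapesIn A-shapes P × All (λ v → HasShape v P) A-shapes

-- Three consecutive positions form an occurrence of both dashed forms, so it does not matter which
-- one `P` contains.
avoids-consecutive : ∀ {a b c} {π : Permutation′ n} → HasShape (a ∷ b ∷ c ∷ []) P → AvoidsAll P π →
  ∀ {i j k} → toℕ j ≡ suc (toℕ i) → toℕ k ≡ suc (toℕ j) →
  ¬ OrderIsomorphic (letters π (i ∷ j ∷ k ∷ [])) (a ∷ b ∷ c ∷ [])
avoids-consecutive v∈P avoids j≡1+i k≡1+j iso with avoids-shape v∈P avoids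
... | inj₁ ¬a-bc = ¬a-bc (_ , _ , _ , adjacent-< j≡1+i , k≡1+j , iso)
... | inj₂ ¬ab-c = ¬ab-c (_ , _ , _ , j≡1+i , adjacent-< k≡1+j , iso)

A-tailDecreasing : A-sufficient P → (π : Permutation′ (suc n)) → AvoidsAll P π → TailDecreasing π
A-tailDecreasing (_ , 123∈P ∷ 213∈P ∷ 312∈P ∷ []) π avoids {i} {j} i<j
  with π ⟨$⟩ʳ suc i <? π ⟨$⟩ʳ suc j
... | no ≮ = ≮⇒> π (<⇒≢ (s≤s i<j)) ≮
... | yes πi<πj
  -- Crossing the level of the letter at `suc i` gives an ascent at adjacent positions `m`, `m′`.
  with m , m′ , i≤m , m′≡1+m , _ , πm≤πi , πm′≰πi ←
    adjacent-step (λ m → π ⟨$⟩ʳ m ≤? π ⟨$⟩ʳ suc i) (s≤s i<j) ℕ.≤-refl (ℕ.<⇒≱ πi<πj)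
  -- Since `m` is at least `suc i`, it is not the first position and has a left neighbour `l`.
  with l , m≡1+l , _ ← predecessor {j = zero} (ℕ.<-≤-trans (s≤s z≤n) i≤m)
  = contradiction (ℕ.≤-<-trans πm≤πi (ℕ.≰⇒> πm′≰πi)) no-ascent
  where
  no-ascent : ¬ π ⟨$⟩ʳ m < π ⟨$⟩ʳ m′
  -- The letter at `l` is below, between or above the two letters of the ascent, giving 123, 213 or
  -- 312.
  no-ascent πm<πm′ with <-cmp (π ⟨$⟩ʳ l) (π ⟨$⟩ʳ m) | <-cmp (π ⟨$⟩ʳ l) (π ⟨$⟩ʳ m′)
  ... | tri< πl<πm _ _ | _ = avoids-consecutive 123∈P avoids m≡1+l m′≡1+m (iso-123 πl<πm πm<πm′)
  ... | tri≈ _ πl≡πm _ | _ = <⇒≢ (adjacent-< m≡1+l) (⟨$⟩ʳ-injective π πl≡πm)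
  ... | tri> _ _ πm<πl | tri< πl<πm′ _ _ =
    avoids-consecutive 213∈P avoids m≡1+l m′≡1+m (iso-213 πm<πl πl<πm′)
  ... | tri> _ _ _ | tri≈ _ πl≡πm′ _ =
    <⇒≢ (ℕ.<-trans (adjacent-< m≡1+l) (adjacent-< m′≡1+m)) (⟨$⟩ʳ-injective π πl≡πm′)
  ... | tri> _ _ _ | tri> _ _ πm′<πl =
    avoids-consecutive 312∈P avoids m≡1+l m′≡1+m (iso-312 πm<πm′ πm′<πl)

A-cardinality : A-sufficient P → HasCardinality (S (suc n) P) (suc n)
A-cardinality suff@(P⊆shapes , _) = cardinality
  (_⟨$⟩ʳ zero) (λ π≈σ → π≈σ zero)
  (λ v → prepend v reverse)
  (λ v → avoidsClassical⇒avoidsAll P⊆shapes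
    (tailDecreasing-avoids (prepend v reverse) (λ i<j → punchIn-mono-< v (opposite-anti-< i<j))))
  (λ _ → refl)
  (λ π avoids → tailDecreasing⇒prepend-reverse π (A-tailDecreasing suff π avoids))

-- Permutations determined by the position of their least letter

-- The two conditions on `Asc` put the letter at `z` below all others in `word z`, so the position
-- of the least letter recovers `z`.
profile-cardinality : (Asc : Fin (suc n) → Rel (Fin (suc n)) 0ℓ) →
  (∀ {z i} → i < z → ¬ Asc z i z) → (∀ {z j} → z < j → Asc z z j) →
  (word : Fin (suc n) → Permutation′ (suc n)) → (∀ z → Profile (Asc z) (word z)) →
  (∀ z → AvoidsAll P (word z)) →
  (∀ π → AvoidsAll P π → Profile (Asc (π ⟨$⟩ˡ zero)) π) →
  HasCardinality (S (suc n) P) (suc n)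
profile-cardinality Asc ¬asc-z asc-z word word-profile avoids profile = cardinality
  (_⟨$⟩ˡ zero)
  (λ {π} {σ} π≈σ → ⟨$⟩ʳ-injective σ
    (trans (trans (sym (π≈σ (π ⟨$⟩ˡ zero))) (inverseʳ π)) (sym (inverseʳ σ))))
  word avoids index-word
  (λ π π-avoids → profile-unique (word-profile _) (profile π π-avoids))
  where
  index-word : ∀ z → word z ⟨$⟩ˡ zero ≡ z
  index-word z with <-cmp (word z ⟨$⟩ˡ zero) z
  ... | tri≈ _ eq _ = eq
  ... | tri< p<z _ _ with compare (word-profile z) p<z
  ...   | inj₁ (asc , _) = contradiction asc (¬asc-z p<z)
  ...   | inj₂ (_ , z<p) = contradiction (subst (word z ⟨$⟩ʳ _ <_) (inverseʳ (word z)) z<p) λ ()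
  index-word z | tri> _ _ z<p with compare (word-profile z) z<p
  ...   | inj₁ (_ , z<p) = contradiction (subst (word z ⟨$⟩ʳ _ <_) (inverseʳ (word z)) z<p) λ ()
  ...   | inj₂ (¬asc , _) = contradiction (asc-z z<p) ¬asc

-- Order of the letters around the least one

module _ (π : Permutation′ (suc n)) where

  private
    πʳ : Fin (suc n) → Fin (suc n)
    πʳ = π ⟨$⟩ʳ_

    z : Fin (suc n)
    z = π ⟨$⟩ˡ zero

  least-letter : ∀ {i} → i ≢ z → πʳ z < πʳ i
  least-letter {i} i≢z rewrite inverseʳ π {zero} =
    ≤∧≢⇒< z≤n (λ 0≡πi → i≢z (⟨$⟩ʳ-injective π (trans (sym 0≡πi) (sym (inverseʳ π)))))

  least-below : ∀ {i} → z < i → πʳ z < πʳ i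
  least-below z<i = least-letter (≢-sym (<⇒≢ z<i))

  -- A rise before `z` contains an adjacent ascent, which the least letter completes to a 231.
  decreasing-before-least : ¬ Contains π 23-1 → ∀ {i j} → i < j → j ≤ z → πʳ j < πʳ i
  decreasing-before-least ¬23-1 {i} {j} i<j j≤z with πʳ i <? πʳ j
  ... | no πi≮πj = ≮⇒> π (<⇒≢ i<j) πi≮πj
  ... | yes πi<πj
    with m , m′ , _ , eq , m′≤j , πm≤πi , πm′≰πi ←
      adjacent-step (λ m → πʳ m ≤? πʳ i) i<j ℕ.≤-refl (ℕ.<⇒≱ πi<πj)
    with πm<πm′ ← ℕ.≤-<-trans πm≤πi (ℕ.≰⇒> πm′≰πi)
    -- `m′` is not `z`: the letter at `z` is zero and cannot exceed the one at `m`.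
    with m′<z ← ≤∧≢⇒< (ℕ.≤-trans m′≤j j≤z)
                 (λ { refl → ℕ.n≮0 (subst (λ v → πʳ m < v) (inverseʳ π) πm<πm′) })
    = contradiction
        (m , m′ , z , eq , m′<z ,
         iso-231 (least-letter (<⇒≢ (ℕ.<-trans (adjacent-< eq) m′<z))) πm<πm′)
        ¬23-1

  -- Here the least letter serves as the 1 in front of an adjacent ascent.
  decreasing-after-least : ¬ Contains π 1-23 → ∀ {i j} → z < i → i < j → πʳ j < πʳ i
  decreasing-after-least ¬1-23 {i} {j} z<i i<j with πʳ i <? πʳ j
  ... | no πi≮πj = ≮⇒> π (<⇒≢ i<j) πi≮πj
  ... | yes πi<πj
    with m , m′ , i≤m , eq , _ , πm≤πi , πm′≰πi ←
      adjacent-step (λ m → πʳ m ≤? πʳ i) i<j ℕ.≤-refl (ℕ.<⇒≱ πi<πj)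
    with z<m ← ℕ.<-≤-trans z<i i≤m
    = contradiction
        (z , m , m′ , z<m , eq , iso-123 (least-below z<m) (ℕ.≤-<-trans πm≤πi (ℕ.≰⇒> πm′≰πi)))
        ¬1-23

  increasing-after-least : ¬ Contains π 1-32 → ∀ {i j} → z < i → i < j → πʳ i < πʳ j
  increasing-after-least ¬1-32 {i} {j} z<i i<j with πʳ j <? πʳ i
  ... | no πj≮πi = ≮⇒> π (≢-sym (<⇒≢ i<j)) πj≮πi
  ... | yes πj<πi
    with m , m′ , i≤m , eq , _ , πi≤πm , πi≰πm′ ←
      adjacent-step (λ m → πʳ i ≤? πʳ m) i<j ℕ.≤-refl (ℕ.<⇒≱ πj<πi)
    with z<m ← ℕ.<-≤-trans z<i i≤m
    = contradiction
        (z , m , m′ , z<m , eq ,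
         iso-132 (least-below (ℕ.<-trans z<m (adjacent-< eq))) (ℕ.<-≤-trans (ℕ.≰⇒> πi≰πm′) πi≤πm))
        ¬1-32

  -- The letter just before `z` and the least letter are an adjacent 21. That letter is at most the
  -- one at `i`, so any later letter above the latter would play the 3.
  descent-across-least : ¬ Contains π 23-1 → ¬ Contains π 21-3 →
                         ∀ {i j} → i < z → z < j → πʳ j < πʳ i
  descent-across-least ¬23-1 ¬21-3 {i} {j} i<z z<j with πʳ i <? πʳ j
  ... | no πi≮πj = ≮⇒> π (<⇒≢ (ℕ.<-trans i<z z<j)) πi≮πj
  ... | yes πi<πj with p , z≡1+p , i≤p ← predecessor i<z
    = contradiction
        (p , z , j , z≡1+p , z<j ,
         iso-213 (least-letter (<⇒≢ (adjacent-< z≡1+p))) (ℕ.≤-<-trans πp≤πi πi<πj))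
        ¬21-3
    where
    πp≤πi : πʳ p ≤ πʳ i
    πp≤πi with i ≟ p
    ... | yes refl = ℕ.≤-refl
    ... | no i≢p = ℕ.<⇒≤ (decreasing-before-least ¬23-1 (≤∧≢⇒< i≤p i≢p)
                           (ℕ.<⇒≤ (adjacent-< z≡1+p)))

  -- A descent from `i` to `j` makes `i`, `z`, `j` a classical 312, which `31-2` forbids. With
  -- `2-31` instead, consider the position `q` right after `z`: a letter there below that at `i`
  -- gives a `3-12`, and one above makes `i`, `q`, `j` a 231.
  ascent-across-least : ¬ Contains π 3-12 → ¬ Contains π 2-31 ⊎ ¬ Contains π 31-2 →
                        ∀ {i j} → i < z → z < j → πʳ i < πʳ j
  ascent-across-least ¬3-12 ¬2-31⊎¬31-2 {i} {j} i<z z<j with πʳ j <? πʳ i | ¬2-31⊎¬31-2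
  ... | no πj≮πi | _ = ≮⇒> π (≢-sym (<⇒≢ (ℕ.<-trans i<z z<j))) πj≮πi
  ... | yes πj<πi | inj₂ ¬31-2 =
    contradiction (312⇒31-2 π (i , z , j , i<z , z<j , iso-312 (least-below z<j) πj<πi)) ¬31-2
  ... | yes πj<πi | inj₁ ¬2-31
    with q , q≡1+z , q≤j ← successor z<j
    with z<q ← adjacent-< q≡1+z
    with i<q ← ℕ.<-trans i<z z<q
    with πʳ q <? πʳ i
  ...   | yes πq<πi =
    contradiction (i , z , q , i<z , q≡1+z , iso-312 (least-below z<q) πq<πi) ¬3-12
  ...   | no πq≮πi
    with πi<πq ← ≮⇒> π (≢-sym (<⇒≢ i<q)) πq≮πi
    with q<j ← ≤∧≢⇒< q≤j (λ { refl → πq≮πi πj<πi })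
    = contradiction (231⇒2-31 π (i , q , j , i<q , q<j , iso-231 πj<πi πi<πq)) ¬2-31

-- Class B

B-Asc : Fin n → Rel (Fin n) 0ℓ
B-Asc z i j = i ≡ z

B-shapes : List (Vec ℕ 3)
B-shapes = (1 ∷ 2 ∷ 3 ∷ []) ∷ (2 ∷ 1 ∷ 3 ∷ []) ∷ (2 ∷ 3 ∷ 1 ∷ []) ∷ []

-- The shape 123 is required as `1-23`, because the least letter may stand far from the adjacent
-- ascent used with it.
B-sufficient : List GenPattern → Set
B-sufficient P =
  ShapesIn B-shapes P × 1-23 ∈ P × HasShape (2 ∷ 1 ∷ 3 ∷ []) P × HasShape (2 ∷ 3 ∷ 1 ∷ []) P

-- Each greatest letter put in front moves the least letter one place to the right.
B-word : Fin n → Permutation′ n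
B-word zero = prepend zero reverse
B-word {suc n@(suc _)} (suc z) = prepend (fromℕ n) (B-word z)

toℕ<fromℕ : (i : Fin n) → toℕ i ℕ.< toℕ (fromℕ n)
toℕ<fromℕ {n} i = subst (toℕ i ℕ.<_) (sym (toℕ-fromℕ n)) (toℕ<n i)

B-word-profile : (z : Fin n) → Profile (B-Asc z) (B-word z)
B-word-profile zero = prepend-profile
  (mk⇔ (λ ()) (λ ())) (λ _ → inj₁ (refl , z≤n)) reverse-profile
B-word-profile {suc (suc _)} (suc z) = prepend-profile
  (mk⇔ (cong suc) suc-injective) (λ _ → inj₂ ((λ ()) , toℕ<fromℕ _)) (B-word-profile z)

-- Whether a pair ascends depends on its left position alone, which excludes 213 and 231. A 123
-- would have two different left positions equal to `z`.
B-avoids : {π : Permutation′ n} {z : Fin n} → Profile (B-Asc z) π → AvoidsClassical B-shapes π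
B-avoids prof =
  (λ (_ , _ , _ , i<j , j<k , iso) → <⇒≢ i<j (trans
    (profile-asc prof i<j (holds (iso 0F 1F)))
    (sym (profile-asc prof j<k (holds (iso 1F 2F)))))) ∷
  (λ (_ , _ , _ , i<j , j<k , iso) → profile-¬asc prof i<j (holds (iso 1F 0F))
    (profile-asc prof (ℕ.<-trans i<j j<k) (holds (iso 0F 2F)))) ∷
  (λ (_ , _ , _ , i<j , j<k , iso) → profile-¬asc prof (ℕ.<-trans i<j j<k) (holds (iso 2F 0F))
    (profile-asc prof i<j (holds (iso 0F 1F)))) ∷ []

B-profile : B-sufficient P → (π : Permutation′ (suc n)) → AvoidsAll P π →
            Profile (B-Asc (π ⟨$⟩ˡ zero)) π
compare (B-profile (_ , 1-23∈P , 213∈P , 231∈P) π avoids) {i} {j} i<j with <-cmp i (π ⟨$⟩ˡ zero)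
... | tri≈ _ refl _ = inj₁ (refl , least-below π i<j)
... | tri> _ i≢z z<i =
  inj₂ (i≢z , decreasing-after-least π (All.lookup avoids 1-23∈P) z<i i<j)
... | tri< i<z i≢z _ with j ≤? π ⟨$⟩ˡ zero
...   | yes j≤z = inj₂ (i≢z , decreasing-before-least π (avoids-23-1 231∈P avoids) i<j j≤z)
...   | no j≰z = inj₂ (i≢z , descent-across-least π (avoids-23-1 231∈P avoids)
                               (avoids-21-3 213∈P avoids) i<z (ℕ.≰⇒> j≰z))

B-cardinality : B-sufficient P → HasCardinality (S (suc n) P) (suc n)
B-cardinality suff@(P⊆shapes , _) = profile-cardinality B-Asc
  <⇒≢ (λ _ → refl) B-word B-word-profile
  (λ z → avoidsClassical⇒avoidsAll P⊆shapes (B-avoids (B-word-profile z)))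
  (B-profile suff)

-- Class C

C-Asc : Fin n → Rel (Fin n) 0ℓ
C-Asc z i j = z ≤ i

C-shapes : List (Vec ℕ 3)
C-shapes = (1 ∷ 3 ∷ 2 ∷ []) ∷ (2 ∷ 1 ∷ 3 ∷ []) ∷ (2 ∷ 3 ∷ 1 ∷ []) ∷ []

C-sufficient : List GenPattern → Set
C-sufficient P = ShapesIn C-shapes P × All (λ v → HasShape v P) C-shapes

C-word : Fin n → Permutation′ n
C-word zero = id
C-word (suc z) = prepend (fromℕ _) (C-word z)

C-word-profile : (z : Fin n) → Profile (C-Asc z) (C-word z)
compare (C-word-profile zero) i<j = inj₁ (z≤n , i<j)
C-word-profile (suc z) = prepend-profile
  (mk⇔ s≤s ℕ.s≤s⁻¹) (λ _ → inj₂ ((λ ()) , toℕ<fromℕ _)) (C-word-profile z)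

-- Again only the left position matters, which excludes 213 and 231. In a 132, the ascent puts `i`,
-- and so also `j`, at or after `z`, where no descent starts.
C-avoids : {π : Permutation′ n} {z : Fin n} → Profile (C-Asc z) π → AvoidsClassical C-shapes π
C-avoids prof =
  (λ (_ , _ , _ , i<j , j<k , iso) → profile-¬asc prof j<k (holds (iso 2F 1F))
    (ℕ.≤-trans (profile-asc prof i<j (holds (iso 0F 1F))) (ℕ.<⇒≤ i<j))) ∷
  (λ (_ , _ , _ , i<j , j<k , iso) → profile-¬asc prof i<j (holds (iso 1F 0F))
    (profile-asc prof (ℕ.<-trans i<j j<k) (holds (iso 0F 2F)))) ∷
  (λ (_ , _ , _ , i<j , j<k , iso) → profile-¬asc prof (ℕ.<-trans i<j j<k) (holds (iso 2F 0F))
    (profile-asc prof i<j (holds (iso 0F 1F)))) ∷ []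

C-profile : C-sufficient P → (π : Permutation′ (suc n)) → AvoidsAll P π →
            Profile (C-Asc (π ⟨$⟩ˡ zero)) π
compare (C-profile (_ , 132∈P ∷ 213∈P ∷ 231∈P ∷ []) π avoids) {i} {j} i<j with <-cmp i (π ⟨$⟩ˡ zero)
... | tri≈ _ refl _ = inj₁ (ℕ.≤-refl , least-below π i<j)
... | tri> _ _ z<i =
  inj₁ (ℕ.<⇒≤ z<i , increasing-after-least π (avoids-1-32 132∈P avoids) z<i i<j)
... | tri< i<z _ _ with j ≤? π ⟨$⟩ˡ zero
...   | yes j≤z =
  inj₂ (ℕ.<⇒≱ i<z , decreasing-before-least π (avoids-23-1 231∈P avoids) i<j j≤z)
...   | no j≰z = inj₂ (ℕ.<⇒≱ i<z , descent-across-least π (avoids-23-1 231∈P avoids)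
                                     (avoids-21-3 213∈P avoids) i<z (ℕ.≰⇒> j≰z))

C-cardinality : C-sufficient P → HasCardinality (S (suc n) P) (suc n)
C-cardinality suff@(P⊆shapes , _) = profile-cardinality C-Asc
  ℕ.<⇒≱ (λ _ → ℕ.≤-refl) C-word C-word-profile
  (λ z → avoidsClassical⇒avoidsAll P⊆shapes (C-avoids (C-word-profile z)))
  (C-profile suff)

-- Class D

D-Asc : Fin n → Rel (Fin n) 0ℓ
D-Asc z i j = i ≤ z × z < j

D-shapes : List (Vec ℕ 3)
D-shapes = (1 ∷ 2 ∷ 3 ∷ []) ∷ (2 ∷ 3 ∷ 1 ∷ []) ∷ (3 ∷ 1 ∷ 2 ∷ []) ∷ []

-- The last component asks for a form with the dash next to the letter 2, through which a classical
-- 231 or 312 is excluded in `ascent-across-least`.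
D-sufficient : List GenPattern → Set
D-sufficient P =
  ShapesIn D-shapes P × 1-23 ∈ P × HasShape (2 ∷ 3 ∷ 1 ∷ []) P × HasShape (3 ∷ 1 ∷ 2 ∷ []) P ×
  (2-31 ∈ P ⊎ 31-2 ∈ P)

D-word : Fin n → Permutation′ n
D-word zero = prepend zero reverse
D-word (suc z) = prepend (suc z) (D-word z)

D-word-first : (z : Fin (suc n)) → D-word z ⟨$⟩ʳ zero ≡ z
D-word-first zero = refl
D-word-first (suc z) = refl

D-word-profile : (z : Fin n) → Profile (D-Asc z) (D-word z)
D-word-profile zero = prepend-profile
  (mk⇔ (λ ()) (λ { (() , _) })) (λ _ → inj₁ ((z≤n , s≤s z≤n) , z≤n)) reverse-profile
D-word-profile {suc n@(suc _)} (suc z) = prepend-profile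
  (mk⇔ (λ (i≤z , z<j) → s≤s i≤z , s≤s z<j) (λ (i≤z , z<j) → ℕ.s≤s⁻¹ i≤z , ℕ.s≤s⁻¹ z<j))
  first (D-word-profile z)
  where
  -- The letter `z` comes first in `D-word z`, so the comparisons at position `zero` tell which
  -- letters exceed it.
  z-vs : ∀ j → (z < j × z < D-word z ⟨$⟩ʳ j) ⊎ (¬ z < j × D-word z ⟨$⟩ʳ j ≤ z)
  z-vs zero = inj₂ ((λ ()) , ℕ.≤-reflexive (cong toℕ (D-word-first z)))
  z-vs (suc j) with compare (D-word-profile z) {zero} {suc j} (s≤s z≤n)
  ... | inj₁ ((_ , z<j) , w₀<wj) = inj₁ (z<j , subst (_< D-word z ⟨$⟩ʳ suc j) (D-word-first z) w₀<wj)
  ... | inj₂ (¬asc , wj<w₀) =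
    inj₂ ((λ z<j → ¬asc (z≤n , z<j)) , ℕ.<⇒≤ (subst (D-word z ⟨$⟩ʳ suc j <_) (D-word-first z) wj<w₀))

  first : ∀ j → (D-Asc (suc z) zero (suc j) × toℕ (suc z) ℕ.≤ toℕ (D-word z ⟨$⟩ʳ j)) ⊎
                (¬ D-Asc (suc z) zero (suc j) × toℕ (D-word z ⟨$⟩ʳ j) ℕ.< toℕ (suc z))
  first j with z-vs j
  ... | inj₁ (z<j , z<wj) = inj₁ ((z≤n , s≤s z<j) , z<wj)
  ... | inj₂ (z≮j , wj≤z) = inj₂ ((λ (_ , z<j) → z≮j (ℕ.s≤s⁻¹ z<j)) , s≤s wj≤z)

-- Ascents lead from the block ending at `z` to the block after it. The middle of a 123 would lie in
-- both blocks; in a 231 or 312 the ascent puts the outer positions in different blocks, so they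
-- ascend too.
D-avoids : {π : Permutation′ n} {z : Fin n} → Profile (D-Asc z) π → AvoidsClassical D-shapes π
D-avoids prof =
  (λ (_ , _ , _ , i<j , j<k , iso) → ℕ.<⇒≱
    (proj₂ (profile-asc prof i<j (holds (iso 0F 1F))))
    (proj₁ (profile-asc prof j<k (holds (iso 1F 2F))))) ∷
  (λ (_ , _ , _ , i<j , j<k , iso) →
    let i≤z , z<j = profile-asc prof i<j (holds (iso 0F 1F)) in
    profile-¬asc prof (ℕ.<-trans i<j j<k) (holds (iso 2F 0F)) (i≤z , ℕ.<-trans z<j j<k)) ∷
  (λ (_ , _ , _ , i<j , j<k , iso) →
    let j≤z , z<k = profile-asc prof j<k (holds (iso 1F 2F)) in
    profile-¬asc prof (ℕ.<-trans i<j j<k) (holds (iso 2F 0F))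
      (ℕ.≤-trans (ℕ.<⇒≤ i<j) j≤z , z<k)) ∷ []

D-profile : D-sufficient P → (π : Permutation′ (suc n)) → AvoidsAll P π →
            Profile (D-Asc (π ⟨$⟩ˡ zero)) π
compare (D-profile (_ , 1-23∈P , 231∈P , 312∈P , 2-31⊎31-2∈P) π avoids) {i} {j} i<j
  with <-cmp i (π ⟨$⟩ˡ zero)
... | tri≈ _ refl _ = inj₁ ((ℕ.≤-refl , i<j) , least-below π i<j)
... | tri> _ _ z<i = inj₂ ((λ (i≤z , _) → ℕ.<⇒≱ z<i i≤z) ,
                           decreasing-after-least π (All.lookup avoids 1-23∈P) z<i i<j)
... | tri< i<z _ _ with j ≤? π ⟨$⟩ˡ zero
...   | yes j≤z = inj₂ ((λ (_ , z<j) → ℕ.<⇒≱ z<j j≤z) ,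
                        decreasing-before-least π (avoids-23-1 231∈P avoids) i<j j≤z)
...   | no j≰z = inj₁ ((ℕ.<⇒≤ i<z , ℕ.≰⇒> j≰z) ,
                       ascent-across-least π (avoids-3-12 312∈P avoids)
                         (Sum.map (All.lookup avoids) (All.lookup avoids) 2-31⊎31-2∈P)
                         i<z (ℕ.≰⇒> j≰z))

D-cardinality : D-sufficient P → HasCardinality (S (suc n) P) (suc n)
D-cardinality suff@(P⊆shapes , _) = profile-cardinality D-Asc
  (λ i<z (_ , z<z) → ℕ.<-irrefl refl z<z) (λ z<j → ℕ.≤-refl , z<j) D-word D-word-profile
  (λ z → avoidsClassical⇒avoidsAll P⊆shapes (D-avoids (D-word-profile z)))
  (D-profile suff)

-- Classification of the 38 sets

_≟ᵛ_ : DecidableEquality (Vec ℕ k)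
_≟ᵛ_ = Vec.≡-dec ℕ._≟_

_≟ᵖ_ : DecidableEquality GenPattern
a-bc a b c ≟ᵖ a-bc a′ b′ c′ = map′ (λ { refl → refl }) (λ { refl → refl })
  ((a ∷ b ∷ c ∷ []) ≟ᵛ (a′ ∷ b′ ∷ c′ ∷ []))
a-bc a b c ≟ᵖ ab-c a′ b′ c′ = no λ ()
ab-c a b c ≟ᵖ a-bc a′ b′ c′ = no λ ()
ab-c a b c ≟ᵖ ab-c a′ b′ c′ = map′ (λ { refl → refl }) (λ { refl → refl })
  ((a ∷ b ∷ c ∷ []) ≟ᵛ (a′ ∷ b′ ∷ c′ ∷ []))

_∈?_ : ∀ p P → Dec (p ∈ P)
p ∈? P = Any.any? (p ≟ᵖ_) P

shapesIn? : ∀ vs P → Dec (ShapesIn vs P)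
shapesIn? vs = All.all? λ p → Any.any? (shape p ≟ᵛ_) vs

hasShape? : ∀ v P → Dec (HasShape v P)
hasShape? v = Any.any? λ p → shape p ≟ᵛ v

Sufficient : List GenPattern → Set
Sufficient P = A-sufficient P ⊎ B-sufficient P ⊎ C-sufficient P ⊎ D-sufficient P

sufficient? : ∀ P → Dec (Sufficient P)
sufficient? P =
  (shapesIn? A-shapes P ×-dec All.all? (λ v → hasShape? v P) A-shapes) ⊎-dec
  (shapesIn? B-shapes P ×-dec 1-23 ∈? P ×-dec hasShape? _ P ×-dec hasShape? _ P) ⊎-dec
  (shapesIn? C-shapes P ×-dec All.all? (λ v → hasShape? v P) C-shapes) ⊎-dec
  (shapesIn? D-shapes P ×-dec 1-23 ∈? P ×-dec hasShape? _ P ×-dec hasShape? _ P ×-dec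
   (2-31 ∈? P ⊎-dec 31-2 ∈? P))

-- A finite check, settled by evaluating the decision procedure.
patternSets-sufficient : All Sufficient patternSets
patternSets-sufficient = from-yes (All.all? sufficient? patternSets)

mainTheorem1 : ∀ (P : List GenPattern) → P ∈ patternSets →
    ∀ (n : ℕ) → n ≥ 1 → HasCardinality (S n P) n
mainTheorem1 P P∈ (suc n) _ =
  [ A-cardinality , [ B-cardinality , [ C-cardinality , D-cardinality ]′ ]′ ]′
    (All.lookup patternSets-sufficient P∈)
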